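{- For each positive integer $r$ there is a constant $c_r$ such that the following holds. Let $\mathcal{H}_r = \{C_3, C_5, \ldots, C_{2r+1}\}$ be the set of odd cycles of length at most $2r+1$. Then for all positive integers $n,k$, $$h(n, k, \mathcal{H}_r) < c_r\frac{n^2}{k^{r+1}}.$$
   Context: All graphs are finite, undirected and simple. For a family $\mathcal{H}$ of graphs, a graph is $\mathcal{H}$-free if it contains no member of $\mathcal{H}$ as a (not necessarily induced) subgraph. For a graph $G$ and a positive integer $k$, $h(G,k)$ is the minimum number of edges that can be deleted from $G$ so that the remaining graph is $k$-colorable. For positive integers $n,k$, $h(n,k,\mathcal{H})$ is the maximum of $h(G,k)$ over all $\mathcal{H}$-free graphs $G$ on $n$ vertices. $C_\ell$ is the cycle of length $\ell$. -}

module Defs where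

open import Level using (0ℓ)
open import Data.Nat using (ℕ; suc; _+_; _*_; _^_; _≤_; z≤n; NonZero; NonTrivial)
open import Data.Empty using (⊥)
import Data.Nat.Properties as ℕₚ
open import Data.Nat.DivMod using (_%_; m<n⇒m%n≡m; n%n≡0)
open import Data.Fin using (Fin; toℕ; finToFun; funToFin; combine; remQuot)
import Data.Fin as Fin
open import Data.Fin.Properties
  using (any?; all?; toℕ<n; finToFun-funToFin; remQuot-combine)
import Data.Fin.Properties as Finₚ
open import Data.List using (List; length; map; filter; allFin; applyUpTo; cartesianProduct)
open import Data.List.Properties using (filter-≐)
open import Data.List.Extrema.Nat using (min; max; min≤xs; xs≤max; argmin-sel; argmax-sel)
open import Data.List.Relation.Unary.All using (All)
import Data.List.Relation.Unary.All as All
open import Data.List.Relation.Unary.All.Properties using (applyUpTo⁺₂)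
open import Data.List.Membership.Propositional using (_∈_)
open import Data.List.Membership.Propositional.Properties
  using (∈-map⁺; ∈-map⁻; ∈-filter⁺; ∈-filter⁻; ∈-allFin)
open import Data.Product using (Σ; ∃; ∃-syntax; _×_; _,_; proj₁; proj₂; uncurry)
open import Data.Sum using (_⊎_; inj₁; inj₂; [_,_]; swap)
open import Function using (_∘_; id)
open import Function.Definitions using (Injective)
open import Relation.Binary using (Rel; Decidable; Symmetric; Irreflexive)
open import Relation.Binary.PropositionalEquality
  using (_≡_; _≢_; _≗_; refl; sym; trans; cong; subst; subst₂)
open import Relation.Nullary using (¬_; Dec; yes; no; contradiction)
open import Relation.Nullary.Decidable using (map′; _×-dec_; _⊎-dec_; _→-dec_; ¬?)

record Graph (n : ℕ) : Set₁ where
  field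
    Adj        : Rel (Fin n) 0ℓ
    adj?       : Decidable Adj
    adj-sym    : Symmetric Adj
    adj-irrefl : Irreflexive _≡_ Adj

open Graph public

private variable
  m n k : ℕ

-- Each edge {i , j} is listed once, as the pair with i < j.
edges : Graph n → List (Fin n × Fin n)
edges {n} G =
  filter (λ (i , j) → i Finₚ.<? j ×-dec adj? G i j)
         (cartesianProduct (allFin n) (allFin n))

e : Graph n → ℕ
e G = length (edges G)

-- Spanning subgraphs of G; these also serve as the subsets of its edge set.
_⊆_ : Graph n → Graph n → Set
D ⊆ G = ∀ i j → Adj D i j → Adj G i j

_─_ : Graph n → Graph n → Graph n
G ─ D = record
  { Adj        = λ i j → Adj G i j × ¬ Adj D i j
  ; adj?       = λ i j → adj? G i j ×-dec ¬? (adj? D i j)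
  ; adj-sym    = λ (g , ¬d) → adj-sym G g , ¬d ∘ adj-sym D
  ; adj-irrefl = λ i≡j → adj-irrefl G i≡j ∘ proj₁
  }

edgeless : ∀ n → Graph n
edgeless n = record
  { Adj        = λ _ _ → ⊥
  ; adj?       = λ _ _ → no id
  ; adj-sym    = id
  ; adj-irrefl = λ _ ()
  }

Proper : Graph n → (Fin n → Fin k) → Set
Proper G c = ∀ i j → Adj G i j → c i ≢ c j

Colourable : ℕ → Graph n → Set
Colourable {n} k G = Σ (Fin n → Fin k) (Proper G)

Embedding : Graph m → Graph n → (Fin m → Fin n) → Set
Embedding H G f = Injective _≡_ _≡_ f × (∀ i j → Adj H i j → Adj G (f i) (f j))

-- G contains H as a not necessarily induced subgraph.
Contains : Graph n → Graph m → Set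
Contains {n} {m} G H = Σ (Fin m → Fin n) (Embedding H G)

FiniteFamily : Set₁
FiniteFamily = List (∃ Graph)

Free : FiniteFamily → Graph n → Set₁
Free ℋ G = All (λ (_ , H) → ¬ Contains G H) ℋ

-- The cycle 0, 1, …, ℓ - 1, 0.  It is a genuine cycle for ℓ ≥ 3; ℓ = 2 gives a single edge.
cycle : ∀ ℓ → .{{NonTrivial ℓ}} → Graph ℓ
cycle ℓ@(suc (suc _)) = record
  { Adj        = λ i j → Next i j ⊎ Next j i
  ; adj?       = λ i j → next? i j ⊎-dec next? j i
  ; adj-sym    = swap
  ; adj-irrefl = λ { {i} refl → [ next-irrefl i , next-irrefl i ] }
  }
  where
  Next : Rel (Fin ℓ) 0ℓ
  Next i j = suc (toℕ i) % ℓ ≡ toℕ j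

  next? : Decidable Next
  next? i j = suc (toℕ i) % ℓ ℕₚ.≟ toℕ j

  next-irrefl : ∀ i → ¬ Next i i
  next-irrefl i eq with ℕₚ.m≤n⇒m<n∨m≡n (toℕ<n i)
  ... | inj₁ 1+i<ℓ = ℕₚ.1+n≢n (trans (sym (m<n⇒m%n≡m 1+i<ℓ)) eq)
  ... | inj₂ 1+i≡ℓ
    with 0≡i ← trans (sym (n%n≡0 ℓ)) (trans (cong (_% ℓ) (sym 1+i≡ℓ)) eq)
    with () ← trans (cong suc 0≡i) 1+i≡ℓ

oddCycles : ℕ → FiniteFamily
oddCycles r = applyUpTo (λ i → _ , cycle (3 + 2 * i)) r

any-fun? : {P : (Fin m → Fin n) → Set} →
           (∀ {f g} → f ≗ g → P f → P g) →
           (∀ f → Dec (P f)) → Dec (∃ P)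
any-fun? resp P? =
  map′ (λ (i , p) → finToFun i , p)
       (λ (f , p) → funToFin f , resp (λ x → sym (finToFun-funToFin f x)) p)
       (any? (λ i → P? (finToFun i)))

⊆? : (D G : Graph n) → Dec (D ⊆ G)
⊆? D G = all? λ i → all? λ j → adj? D i j →-dec adj? G i j

colourable? : ∀ k (G : Graph n) → Dec (Colourable k G)
colourable? k G = any-fun?
  (λ {f} {g} f≗g p i j a gi≡gj → p i j a (trans (f≗g i) (trans gi≡gj (sym (f≗g j)))))
  (λ c → all? λ i → all? λ j → adj? G i j →-dec ¬? (c i Finₚ.≟ c j))

contains? : (G : Graph n) (H : Graph m) → Dec (Contains G H)
contains? G H = any-fun? resp λ f →
  map′ (λ inj {i} {j} → inj i j) (λ inj i j → inj {i} {j})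
       (all? λ i → all? λ j → (f i Finₚ.≟ f j) →-dec (i Finₚ.≟ j))
  ×-dec (all? λ i → all? λ j → adj? H i j →-dec adj? G (f i) (f j))
  where
  resp : ∀ {f g} → f ≗ g → Embedding H G f → Embedding H G g
  resp f≗g (inj , hom) =
    (λ {i} {j} gi≡gj → inj (trans (f≗g i) (trans gi≡gj (sym (f≗g j))))) ,
    (λ i j a → subst₂ (Adj G) (f≗g i) (f≗g j) (hom i j a))

free? : (ℋ : FiniteFamily) (G : Graph n) → Dec (Free ℋ G)
free? ℋ G = All.all? (λ (_ , H) → ¬? (contains? G H)) ℋ

decode : ∀ n → Fin (2 ^ (n * n)) → Graph n
decode n x = record
  { Adj        = λ i j → i ≢ j × (Bit i j ⊎ Bit j i)
  ; adj?       = λ i j → ¬? (i Finₚ.≟ j) ×-dec (bit? i j ⊎-dec bit? j i)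
  ; adj-sym    = λ (i≢j , b) → i≢j ∘ sym , swap b
  ; adj-irrefl = λ i≡j (i≢j , _) → i≢j i≡j
  }
  where
  Bit : Rel (Fin n) 0ℓ
  Bit i j = finToFun {2} {n * n} x (combine i j) ≡ Fin.suc Fin.zero

  bit? : Decidable Bit
  bit? i j = _ Finₚ.≟ _

-- Every graph on Fin n occurs here up to equality of adjacency relations (graphs-complete below).
graphs : ∀ n → List (Graph n)
graphs n = map (decode n) (allFin (2 ^ (n * n)))

-- h(G, k): the least e D over edge sets D ⊆ E(G) such that G ─ D is k-colourable.
-- The first argument of min is the value at D = G, which is admissible whenever k ≥ 1.
-- hᴳ-attained and hᴳ-minimal show that, for k ≥ 1, this is the minimum over all D : Graph n.
hᴳ : Graph n → ℕ → ℕ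
hᴳ {n} G k =
  min (e G) (map e (filter (λ D → ⊆? D G ×-dec colourable? k (G ─ D)) (graphs n)))

-- h(n, k, ℋ), with value 0 if there is no ℋ-free graph on n vertices.
-- Otherwise it is the maximum over all ℋ-free G : Graph n (h-maximal, h-attained), and this is
-- the case for oddCycles r (edgeless-free).
h : ℕ → ℕ → FiniteFamily → ℕ
h n k ℋ = max 0 (map (λ G → hᴳ G k) (filter (free? ℋ) (graphs n)))

_≈_ : Graph n → Graph n → Set
G ≈ G′ = G ⊆ G′ × G′ ⊆ G

graphs-complete : (G : Graph n) → ∃[ G′ ] G′ ∈ graphs n × G′ ≈ G
graphs-complete {n} G =
  decode n code , ∈-map⁺ (decode n) (∈-allFin code) , to , from
  where
  bit : ∀ {A : Set} → Dec A → Fin 2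
  bit (yes _) = Fin.suc Fin.zero
  bit (no  _) = Fin.zero

  bits : Fin (n * n) → Fin 2
  bits x = bit (uncurry (adj? G) (remQuot n x))

  code : Fin (2 ^ (n * n))
  code = funToFin bits

  unbit : ∀ {A : Set} (A? : Dec A) → bit A? ≡ Fin.suc Fin.zero → A
  unbit (yes a) _ = a

  tobit : ∀ {A : Set} (A? : Dec A) → A → bit A? ≡ Fin.suc Fin.zero
  tobit (yes _) _ = refl
  tobit (no ¬a) a = contradiction a ¬a

  look : ∀ i j → finToFun code (combine i j) ≡ bit (adj? G i j)
  look i j = trans (finToFun-funToFin bits (combine i j))
                   (cong (bit ∘ uncurry (adj? G)) (remQuot-combine i j))

  to : decode n code ⊆ G
  to i j (_ , inj₁ b) = unbit (adj? G i j) (trans (sym (look i j)) b)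
  to i j (_ , inj₂ b) = adj-sym G (unbit (adj? G j i) (trans (sym (look j i)) b))

  from : G ⊆ decode n code
  from i j a = (λ i≡j → adj-irrefl G i≡j a) ,
               inj₁ (trans (look i j) (tobit (adj? G i j) a))

e-cong : {G G′ : Graph n} → G ≈ G′ → e G ≡ e G′
e-cong {n} (to , from) =
  cong length (filter-≐ _ _
    ((λ { {i , j} (i<j , a) → i<j , to i j a }) ,
     (λ { {i , j} (i<j , a) → i<j , from i j a }))
    (cartesianProduct (allFin n) (allFin n)))

colourable-mono : {G G′ : Graph n} → G ⊆ G′ → Colourable k G′ → Colourable k G
colourable-mono G⊆G′ (c , p) = c , λ i j a → p i j (G⊆G′ i j a)

free-mono : {G G′ : Graph n} → ∀ ℋ → G ⊆ G′ → Free ℋ G′ → Free ℋ G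
free-mono ℋ G⊆G′ = All.map λ ¬c (f , inj , hom) →
  ¬c (f , inj , λ i j a → G⊆G′ _ _ (hom i j a))

hᴳ-attained : (G : Graph n) (k : ℕ) .{{_ : NonZero k}} →
              ∃[ D ] D ⊆ G × Colourable k (G ─ D) × e D ≡ hᴳ G k
hᴳ-attained {n} G k@(suc _)
  with argmin-sel id (e G)
         (map e (filter (λ D → ⊆? D G ×-dec colourable? k (G ─ D)) (graphs n)))
... | inj₁ eq = G , (λ _ _ a → a) ,
                ((λ _ → Fin.zero) , λ _ _ (a , ¬a) → contradiction a ¬a) , sym eq
... | inj₂ mem with ∈-map⁻ e mem
...   | D , D∈ , eq with ∈-filter⁻ (λ D → ⊆? D G ×-dec colourable? k (G ─ D)) {xs = graphs n} D∈
...     | _ , D⊆G , col = D , D⊆G , col , sym eq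

hᴳ-minimal : (G : Graph n) (k : ℕ) (D : Graph n) →
             D ⊆ G → Colourable k (G ─ D) → hᴳ G k ≤ e D
hᴳ-minimal {n} G k D D⊆G col with graphs-complete D
... | D′ , D′∈ , to , from =
  subst (hᴳ G k ≤_) (e-cong {G = D′} {D} (to , from))
    (All.lookup (min≤xs (e G) _) (∈-map⁺ e (∈-filter⁺
      (λ D → ⊆? D G ×-dec colourable? k (G ─ D)) D′∈
      ( (λ i j a → D⊆G i j (to i j a))
      , colourable-mono {G = G ─ D′} {G ─ D} (λ i j (g , ¬d) → g , ¬d ∘ from i j) col))))

hᴳ-mono : {G G′ : Graph n} (k : ℕ) .{{_ : NonZero k}} → G ≈ G′ → hᴳ G k ≤ hᴳ G′ k
hᴳ-mono {G = G} {G′} k (to , from) with hᴳ-attained G′ k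
... | D , D⊆G′ , col , eq = subst (hᴳ G k ≤_) eq
  (hᴳ-minimal G k D (λ i j a → from i j (D⊆G′ i j a))
    (colourable-mono {G = G ─ D} {G′ ─ D} (λ i j (g , ¬d) → to i j g , ¬d) col))

h-maximal : (k : ℕ) .{{_ : NonZero k}} (ℋ : FiniteFamily) (G : Graph n) →
            Free ℋ G → hᴳ G k ≤ h n k ℋ
h-maximal {n} k ℋ G fr with graphs-complete G
... | G′ , G′∈ , to , from =
  ℕₚ.≤-trans (hᴳ-mono {G = G} {G′} k (from , to))
    (All.lookup (xs≤max 0 _) (∈-map⁺ (λ G → hᴳ G k)
      (∈-filter⁺ (free? ℋ) G′∈ (free-mono {G = G′} {G} ℋ to fr))))

h-attained : (k : ℕ) .{{_ : NonZero k}} (ℋ : FiniteFamily) (G₀ : Graph n) → Free ℋ G₀ →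
             Σ (Graph n) λ G → Free ℋ G × hᴳ G k ≡ h n k ℋ
h-attained {n} k ℋ G₀ fr
  with argmax-sel id 0 (map (λ G → hᴳ G k) (filter (free? ℋ) (graphs n)))
... | inj₁ eq = G₀ , fr , ℕₚ.≤-antisym (h-maximal k ℋ G₀ fr)
                                       (subst (_≤ hᴳ G₀ k) (sym eq) z≤n)
... | inj₂ mem with ∈-map⁻ (λ G → hᴳ G k) mem
...   | G , G∈ , eq = G , proj₂ (∈-filter⁻ (free? ℋ) {xs = graphs n} G∈) , sym eq

edgeless-free : ∀ n r → Free (oddCycles r) (edgeless n)
edgeless-free n r = applyUpTo⁺₂ (λ i → _ , cycle (3 + 2 * i)) r λ i (_ , _ , hom) →
  hom Fin.zero (Fin.suc Fin.zero) (inj₁ refl)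

{-# OPTIONS --safe #-}

-- In a graph without odd cycles of length at most 2r + 1, the vertices reachable from a fixed
-- vertex by walks of length exactly i form an independent set Sᵢ for every i ≤ r.  Suppose every
-- degree exceeds N/Kʳ, where N bounds the number of vertices.  As |Sᵢ| grows from more than N/Kʳ
-- to at most N between i = 1 and i = r + 1, some i ≤ r has |Sᵢ₊₁| ≤ K|Sᵢ|.  Such an Sᵢ joins an
-- independent set I, and its neighbourhood Sᵢ₊₁ is postponed.  A vertex of degree at most N/Kʳ is
-- instead put into a set A, and A is coloured greedily with K colours at a cost of at most
-- N/Kʳ⁺¹ monochromatic edges per vertex.  Whichever of A and I is large is coloured with fresh
-- colours; repeating this with O(K) colours leaves at most N/2ʳ⁺¹ vertices.  These are treated
-- in the same way with K halved: the numbers of colours form a geometric series, and so do the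
-- costs, because (N/2ʳ⁺¹)²/(K/2)ʳ⁺¹ is at most half of N²/Kʳ⁺¹.
module Submission where

open import Defs
open import Data.Nat using (ℕ; _+_; _^_; NonZero)
open import Data.Nat.Properties using (m^n≢0)
open import Data.Product using (Σ)

open import Data.Bool using (true; false)
open import Data.Empty using (⊥-elim)
open import Data.Fin as Fin using (Fin; toℕ; fromℕ<)
import Data.Fin.Properties as Finₚ
import Data.Integer as ℤ
import Data.Integer.Properties as ℤₚ
open import Data.List using (List; []; _∷_; [_]; _++_; map; length; filter; allFin; cartesianProduct)
open import Data.List.Properties
  using (length-++; length-map; length-filter; length-tabulate; filter-++; filter-≐; filter-none;
         map-++; map-∘; map-id)
open import Data.List.Membership.Propositional using (_∈_; find; lose)
open import Data.List.Membership.Propositional.Properties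
  using (∈-∃++; ∈-++⁺ˡ; ∈-++⁺ʳ; ∈-++⁻; ∈-map⁺; ∈-map⁻; ∈-filter⁺; ∈-filter⁻; ∈-allFin)
open import Data.List.Relation.Binary.Permutation.Propositional
  using (_↭_; ↭-refl; ↭-sym; ↭-trans; ↭-reflexive; prep; module PermutationReasoning)
open import Data.List.Relation.Binary.Permutation.Propositional.Properties as ↭ₚ
  using (↭-length; ∈-resp-↭; filter-↭)
open import Data.List.Relation.Unary.All as All using (All; []; _∷_)
import Data.List.Relation.Unary.All.Properties as Allₚ
import Data.List.Relation.Unary.AllPairs as AllPairs
open import Data.List.Relation.Unary.Any as Any using (Any; here; there)
open import Data.List.Relation.Unary.Unique.Propositional using () renaming (Unique to UniqueList)
import Data.List.Relation.Unary.Unique.Propositional.Properties as Uniqueₚ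
import Data.Nat as ℕ
open import Data.Nat using (zero; suc; _≤_; z≤n; s≤s; s≤s⁻¹; _≤?_; _≟_; >-nonZero⁻¹)
open import Data.Nat.DivMod using (_%_; m<n⇒m%n≡m; n%n≡0)
open import Data.Nat.Induction using (<-wellFounded)
import Data.Nat.Properties as ℕₚ
open import Data.Nat.Tactic.RingSolver using (solve-∀)
open import Data.Product using (Σ-syntax; ∃-syntax; _×_; _,_; proj₁; proj₂)
import Data.Rational.Properties as ℚₚ
open import Data.Rational.Unnormalised using (mkℚᵘ; *<*)
import Data.Rational.Unnormalised.Properties as ℚᵘₚ
open import Data.Sum using (_⊎_; inj₁; inj₂)
open import Data.Vec as Vec using (Vec; []; _∷_)
open import Data.Vec.Membership.Propositional using () renaming (_∈_ to _∈ᵥ_)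
open import Data.Vec.Relation.Unary.All as VAll using ([]; _∷_)
import Data.Vec.Relation.Unary.AllPairs as VAllPairs
open import Data.Vec.Relation.Unary.Any as VAny using (here; there)
open import Data.Vec.Relation.Unary.Unique.Propositional using (Unique)
open import Data.Vec.Relation.Unary.Unique.Propositional.Properties using (lookup-injective)
open import Function using (_∘_; id)
open import Induction.WellFounded using (Acc; acc)
open import Relation.Binary.PropositionalEquality
  using (_≡_; _≢_; refl; sym; trans; cong; cong₂; subst; subst₂; module ≡-Reasoning)
open import Relation.Nullary using (¬_; yes; no; does; contradiction)
open import Relation.Nullary.Decidable using (_×-dec_; ¬?)
open import Relation.Unary using (Decidable)

module _ where

  open import Data.Nat using (_*_; _<_)

  private variable
    n r ℓ ℓ₁ ℓ₂ : ℕ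
    x y z : Fin n

  -- Walks and odd cycles

  data Walk (G : Graph n) : ℕ → Fin n → Fin n → Set where
    []  : Walk G 0 x x
    _∷_ : Adj G x y → Walk G ℓ y z → Walk G (suc ℓ) x z

  infixr 5 _⧺_

  _⧺_ : ∀ {G : Graph n} → Walk G ℓ₁ x y → Walk G ℓ₂ y z → Walk G (ℓ₁ + ℓ₂) x z
  []      ⧺ w = w
  (a ∷ v) ⧺ w = a ∷ (v ⧺ w)

  walk-∷ʳ : ∀ {G : Graph n} → Walk G ℓ x y → Adj G y z → Walk G (suc ℓ) x z
  walk-∷ʳ []      a = a ∷ []
  walk-∷ʳ (b ∷ w) a = b ∷ walk-∷ʳ w a

  reverse : ∀ {G : Graph n} → Walk G ℓ x y → Walk G ℓ y x
  reverse         []      = []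
  reverse {G = G} (a ∷ w) = walk-∷ʳ (reverse w) (adj-sym G a)

  -- The final vertex is left out, so that a closed walk lists each visit once.
  vertices : ∀ {G : Graph n} → Walk G ℓ x y → Vec (Fin n) ℓ
  vertices           []      = []
  vertices {x = x}   (_ ∷ w) = x ∷ vertices w

  split-at : ∀ {G : Graph n} {u} (w : Walk G ℓ x y) → u ∈ᵥ vertices w →
             ∃[ a ] ∃[ c ] a + suc c ≡ ℓ × Walk G a x u × Walk G (suc c) u y
  split-at w@(_ ∷ _) (here refl) = 0 , _ , refl , [] , w
  split-at (a ∷ w) (there u∈w) with split-at w u∈w
  ... | _ , c , eq , v₁ , v₂ = _ , c , cong suc eq , a ∷ v₁ , v₂

  -- The last two pieces are nonempty, so the closed piece at `u` is nonempty and the walk that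
  -- remains after cutting it out is nonempty as well.
  Loop : ∀ {G : Graph n} → Walk G ℓ x y → Set
  Loop {n} {ℓ} {x} {y} {G} _ =
    ∃[ a ] ∃[ b ] ∃[ c ] a + (suc b + suc c) ≡ ℓ ×
    Σ[ u ∈ Fin n ] Walk G a x u × Walk G (suc b) u u × Walk G (suc c) u y

  unique-or-loop : ∀ {G : Graph n} (w : Walk G ℓ x y) → Unique (vertices w) ⊎ Loop w
  unique-or-loop [] = inj₁ VAllPairs.[]
  unique-or-loop {x = x} (a ∷ w) with unique-or-loop w
  ... | inj₂ (_ , b , c , eq , u , v₁ , v₂ , v₃) =
    inj₂ (_ , b , c , cong suc eq , u , a ∷ v₁ , v₂ , v₃)
  ... | inj₁ uniq with VAny.any? (x Finₚ.≟_) (vertices w)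
  ...   | yes x∈w with split-at w x∈w
  ...     | b , c , eq , v₁ , v₂ = inj₂ (0 , b , c , cong suc eq , x , [] , a ∷ v₁ , v₂)
  unique-or-loop {x = x} (a ∷ w) | inj₁ uniq | no x∉w =
    inj₁ (fresh (vertices w) x∉w VAllPairs.∷ uniq)
    where
    fresh : ∀ {m} (xs : Vec _ m) → ¬ x ∈ᵥ xs → VAll.All (x ≢_) xs
    fresh []       _  = []
    fresh (y ∷ xs) ∉ = (λ x≡y → ∉ (here x≡y)) ∷ fresh xs (λ ∈ → ∉ (there ∈))

  lookup-step : ∀ {G : Graph n} (w : Walk G ℓ x y) i j → suc (toℕ i) ≡ toℕ j →
                Adj G (Vec.lookup (vertices w) i) (Vec.lookup (vertices w) j)
  lookup-step (a ∷ _ ∷ _) Fin.zero    (Fin.suc Fin.zero) _  = a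
  lookup-step (_ ∷ w)     (Fin.suc i) (Fin.suc j)        eq = lookup-step w i j (ℕₚ.suc-injective eq)

  lookup-last : ∀ {G : Graph n} (w : Walk G ℓ x y) i → suc (toℕ i) ≡ ℓ →
                Adj G (Vec.lookup (vertices w) i) y
  lookup-last (a ∷ [])        Fin.zero    _  = a
  lookup-last (_ ∷ w@(_ ∷ _)) (Fin.suc i) eq = lookup-last w i (ℕₚ.suc-injective eq)

  lookup-zero : ∀ {G : Graph n} (w : Walk G (suc ℓ) x y) → Vec.lookup (vertices w) Fin.zero ≡ x
  lookup-zero (_ ∷ _) = refl

  -- The vertices of the walk, in order, are the embedding. The length enters through an equation
  -- because `2 * suc j` does not reduce to `2 + 2 * j`.
  unique-closed-walk : ∀ {G : Graph n} {m} → ℓ ≡ 2 + m →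
                       (w : Walk G ℓ x x) → Unique (vertices w) → Contains G (cycle (2 + m))
  unique-closed-walk {n} {_} {x} {G} {m} refl w uniq =
    f , (λ {i} {j} → lookup-injective uniq i j) ,
    λ { i j (inj₁ i→j) → next i j i→j ; i j (inj₂ j→i) → adj-sym G (next j i j→i) }
    where
    f : Fin (2 + m) → Fin n
    f = Vec.lookup (vertices w)

    next : ∀ i j → suc (toℕ i) % (2 + m) ≡ toℕ j → Adj G (f i) (f j)
    next i j eq with ℕₚ.m≤n⇒m<n∨m≡n (Finₚ.toℕ<n i)
    ... | inj₁ 1+i<ℓ = lookup-step w i j (trans (sym (m<n⇒m%n≡m 1+i<ℓ)) eq)
    -- At the last position the remainder is 0, and the last edge of the walk leads back to its
    -- first vertex.
    ... | inj₂ 1+i≡ℓ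
      with j | trans (sym (n%n≡0 (2 + m))) (trans (cong (_% (2 + m)) (sym 1+i≡ℓ)) eq)
    ...   | Fin.zero | _ = subst (Adj G (f i)) (sym (lookup-zero w)) (lookup-last w i 1+i≡ℓ)

  parity : ∀ m → (∃[ j ] m ≡ 2 * j) ⊎ (∃[ j ] m ≡ suc (2 * j))
  parity zero = inj₁ (0 , refl)
  parity (suc m) with parity m
  ... | inj₁ (j , refl) = inj₂ (j , refl)
  ... | inj₂ (j , refl) = inj₁ (suc j , sym (ℕₚ.*-suc 2 j))

  NoOddWalk : ℕ → Graph n → Set
  NoOddWalk r G = ∀ {j x} → j ≤ r → ¬ Walk G (suc (2 * j)) x x

  -- For a `Loop` whose closed piece has odd length `2 * b + 1`: the induction can continue with
  -- that piece.
  even-loop-shorter : ∀ a b c {j} → a + (suc (2 * b) + suc c) ≡ suc (2 * suc j) → b < suc j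
  even-loop-shorter a b c {j} eq = ℕₚ.*-cancelˡ-< 2 b (suc j) (s≤s⁻¹ (begin
    2 + 2 * b                  ≤⟨ ℕₚ.m≤m+n (2 + 2 * b) (a + c) ⟩
    2 + 2 * b + (a + c)        ≡⟨ rearrange a b c ⟩
    a + (suc (2 * b) + suc c)  ≡⟨ eq ⟩
    suc (2 * suc j)            ∎))
    where
    open ℕₚ.≤-Reasoning
    rearrange : ∀ a b c → 2 + 2 * b + (a + c) ≡ a + (suc (2 * b) + suc c)
    rearrange = solve-∀

  -- For a `Loop` whose closed piece has even length `2 * b + 2`: cutting it out leaves length
  -- `a + c + 1`, which is therefore odd and at most `2 * j + 1`.
  odd-loop-rest : ∀ a b c {j} → a + (suc (suc (2 * b)) + suc c) ≡ suc (2 * suc j) →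
                  (a + c) + 2 * b ≡ 2 * j
  odd-loop-rest a b c {j} eq =
    ℕₚ.+-cancelˡ-≡ 3 _ _ (trans (rearrange a b c) (trans eq (unfold j)))
    where
    rearrange : ∀ a b c → 3 + (a + c + 2 * b) ≡ a + (suc (suc (2 * b)) + suc c)
    rearrange = solve-∀
    unfold : ∀ j → suc (2 * suc j) ≡ 3 + 2 * j
    unfold = solve-∀

  -- At a repeated vertex a closed walk splits into two shorter ones, and if the walk has odd
  -- length, then so has one of the two.
  free⇒noOddWalk : {G : Graph n} → Free (oddCycles r) G → NoOddWalk r G
  free⇒noOddWalk {r = r} {G = G} free {j} = go j (<-wellFounded j)
    where
    go : ∀ j {x} → Acc _<_ j → j ≤ r → ¬ Walk G (suc (2 * j)) x x
    go zero        _         _   (a ∷ []) = adj-irrefl G refl a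
    go (suc j) {x} (acc rec) j<r w    with unique-or-loop w
    ... | inj₁ uniq =
      -- The walk has length `2 * j + 3`, the length of the cycle at index `j` in `oddCycles r`,
      -- whose indices run below `r`.
      Allₚ.applyUpTo⁻ _ _ free j<r (unique-closed-walk (cong suc (ℕₚ.*-suc 2 j)) w uniq)
    ... | inj₂ (a , b , c , eq , u , v₁ , v₂ , v₃) with parity b
    ...   | inj₁ (b′ , refl) = go b′ (rec b′<1+j) (ℕₚ.<⇒≤ (ℕₚ.<-≤-trans b′<1+j j<r)) v₂
      where
      b′<1+j : b′ < suc j
      b′<1+j = even-loop-shorter a b′ c eq
    ...   | inj₂ (b′ , refl) with parity (a + c)
    ...     | inj₁ (d , a+c≡2d) =
      go d (rec (s≤s d≤j)) (ℕₚ.≤-trans d≤j (ℕₚ.<⇒≤ j<r))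
        (subst (λ ℓ → Walk G ℓ x x) (trans (ℕₚ.+-suc a c) (cong suc a+c≡2d)) (v₁ ⧺ v₃))
      where
      d≤j : d ≤ j
      d≤j = ℕₚ.*-cancelˡ-≤ 2 (subst₂ _≤_ a+c≡2d (odd-loop-rest a b′ c eq) (ℕₚ.m≤m+n (a + c) (2 * b′)))
    ...     | inj₂ (d , a+c≡1+2d) = ⊥-elim (ℕₚ.even≢odd j (d + b′)
      (trans (sym (odd-loop-rest a b′ c eq))
             (trans (cong (_+ 2 * b′) a+c≡1+2d) (cong suc (sym (ℕₚ.*-distribˡ-+ 2 d b′))))))

  -- Colourings with few monochromatic edges

  filter-map : ∀ {A B : Set} {P : B → Set} (P? : Decidable P) (f : A → B) xs →
               filter P? (map f xs) ≡ map f (filter (P? ∘ f) xs)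
  filter-map P? f []       = refl
  filter-map P? f (x ∷ xs) with does (P? (f x))
  ... | true  = cong (f x ∷_) (filter-map P? f xs)
  ... | false = filter-map P? f xs

  filter-split : ∀ {A : Set} {P : A → Set} (P? : Decidable P) xs →
                 xs ↭ filter P? xs ++ filter (¬? ∘ P?) xs
  filter-split P? []       = ↭-refl
  filter-split P? (x ∷ xs) with does (P? x)
  ... | true  = prep x (filter-split P? xs)
  ... | false = ↭-trans (prep x (filter-split P? xs)) (↭-sym (↭ₚ.shift x (filter P? xs) _))

  length-split : ∀ {A : Set} {xs : List A} ys {zs} → xs ↭ ys ++ zs →
                 length xs ≡ length ys + length zs
  length-split ys xs↭ = trans (↭-length xs↭) (length-++ ys)

  unique-⊆⇒length≤ : ∀ {A : Set} {xs ys : List A} → UniqueList xs →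
                     (∀ {x} → x ∈ xs → x ∈ ys) → length xs ≤ length ys
  unique-⊆⇒length≤ {xs = []}     _                        _     = z≤n
  unique-⊆⇒length≤ {xs = x ∷ xs} (x∉xs AllPairs.∷ uniq) xs⊆ys
    with as , bs , refl ← ∈-∃++ (xs⊆ys (here refl)) = begin
    suc (length xs)         ≤⟨ s≤s (unique-⊆⇒length≤ uniq rest) ⟩
    suc (length (as ++ bs)) ≡⟨ ↭-length (↭ₚ.shift x as bs) ⟨
    length (as ++ x ∷ bs)   ∎
    where
    open ℕₚ.≤-Reasoning
    rest : ∀ {y} → y ∈ xs → y ∈ as ++ bs
    rest y∈xs with ∈-resp-↭ (↭ₚ.shift x as bs) (xs⊆ys (there y∈xs))
    ... | here y≡x = contradiction (sym y≡x) (All.lookup x∉xs y∈xs)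
    ... | there y∈ = y∈

  occurrences : ℕ → List ℕ → ℕ
  occurrences c xs = length (filter (_≟ c) xs)

  -- Pigeonhole by induction: if the last colour is too frequent, a colour that is rare among the
  -- remaining entries is rarer than the last one, so it stays rare when those entries return.
  rare-colour : ∀ m xs → ∃[ c ] c ≤ m × suc m * occurrences c xs ≤ length xs
  rare-colour zero xs =
    0 , z≤n , ℕₚ.≤-trans (ℕₚ.≤-reflexive (ℕₚ.+-identityʳ _)) (length-filter (_≟ 0) xs)
  rare-colour (suc m) xs with suc (suc m) * occurrences (suc m) xs ≤? length xs
  ... | yes few = suc m , ℕₚ.≤-refl , few
  ... | no many with rare-colour m (filter (¬? ∘ (_≟ suc m)) xs)
  ...   | c , c≤m , few = c , ℕₚ.m≤n⇒m≤1+n c≤m , (begin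
    suc (suc m) * t ≤⟨ ℕₚ.+-mono-≤ (ℕₚ.<⇒≤ t<o) few′ ⟩
    o + length rest ≡⟨ split ⟨
    length xs       ∎)
    where
    open ℕₚ.≤-Reasoning
    last rest : List ℕ
    last = filter (_≟ suc m) xs
    rest = filter (¬? ∘ (_≟ suc m)) xs
    o t : ℕ
    o = length last
    t = occurrences c xs

    split : length xs ≡ o + length rest
    split = length-split last (filter-split (_≟ suc m) xs)

    absent : filter (_≟ c) last ≡ []
    absent = filter-none (_≟ c)
      (All.map (λ { refl refl → ℕₚ.<-irrefl refl c≤m }) (Allₚ.all-filter (_≟ suc m) xs))

    t≡ : t ≡ occurrences c rest
    t≡ = trans (length-split (filter (_≟ c) last)
                 (↭-trans (filter-↭ (_≟ c) (filter-split (_≟ suc m) xs))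
                          (↭-reflexive (filter-++ (_≟ c) last rest))))
               (cong ((_+ occurrences c rest) ∘ length) absent)

    few′ : suc m * t ≤ length rest
    few′ = subst (λ k → suc m * k ≤ length rest) (sym t≡) few

    -- `suc m * t` is at most the length of `rest`, which is less than `suc m * o` because the last
    -- colour is frequent.
    t<o : t < o
    t<o = ℕₚ.*-cancelˡ-< (suc m) t o (ℕₚ.+-cancelˡ-< o _ _ (begin-strict
      o + suc m * t       ≤⟨ ℕₚ.+-monoʳ-≤ o few′ ⟩
      o + length rest     ≡⟨ split ⟨
      length xs           <⟨ ℕₚ.≰⇒> many ⟩
      suc (suc m) * o     ∎))

  module Colouring (G : Graph n) where

    private variable
      q q′ b b′ : ℕ

    Coloured : Set
    Coloured = List (Fin n × ℕ)

    colouredNeighbours : Fin n → Coloured → Coloured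
    colouredNeighbours v = filter (adj? G v ∘ proj₁)

    clashes : Fin n → ℕ → Coloured → Coloured
    clashes v c L = filter ((_≟ c) ∘ proj₂) (colouredNeighbours v L)

    clashes-++ : ∀ v c L M → clashes v c (L ++ M) ≡ clashes v c L ++ clashes v c M
    clashes-++ v c L M =
      trans (cong (filter ((_≟ c) ∘ proj₂)) (filter-++ (adj? G v ∘ proj₁) L M))
            (filter-++ ((_≟ c) ∘ proj₂) (colouredNeighbours v L) (colouredNeighbours v M))

    -- When no vertex is repeated, each monochromatic edge is counted once, at the end point that
    -- comes first in the list.
    bad : Coloured → ℕ
    bad []            = 0
    bad ((v , c) ∷ L) = length (clashes v c L) + bad L

    bad≤ : ∀ L → bad L ≤ length L * length L
    bad≤ []            = z≤n
    bad≤ ((v , c) ∷ L) = begin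
      length (clashes v c L) + bad L   ≤⟨ ℕₚ.+-mono-≤ clash≤ (bad≤ L) ⟩
      l + l * l                        ≤⟨ ℕₚ.+-mono-≤ (ℕₚ.n≤1+n l) (ℕₚ.*-monoʳ-≤ l (ℕₚ.n≤1+n l)) ⟩
      suc l + l * suc l                ∎
      where
      open ℕₚ.≤-Reasoning
      l : ℕ
      l = length L
      clash≤ : length (clashes v c L) ≤ l
      clash≤ = ℕₚ.≤-trans (length-filter ((_≟ c) ∘ proj₂) (colouredNeighbours v L))
                          (length-filter (adj? G v ∘ proj₁) L)

    recolour : ℕ → Fin n × ℕ → Fin n × ℕ
    recolour q (v , c) = v , q + c

    clashes-recolour : ∀ q v c L →
      clashes v (q + c) (map (recolour q) L) ≡ map (recolour q) (clashes v c L)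
    clashes-recolour q v c L = begin
      filter ((_≟ q + c) ∘ proj₂) (filter (adj? G v ∘ proj₁) (map (recolour q) L))
        ≡⟨ cong (filter ((_≟ q + c) ∘ proj₂)) (filter-map (adj? G v ∘ proj₁) (recolour q) L) ⟩
      filter ((_≟ q + c) ∘ proj₂) (map (recolour q) (colouredNeighbours v L))
        ≡⟨ filter-map ((_≟ q + c) ∘ proj₂) (recolour q) (colouredNeighbours v L) ⟩
      map (recolour q) (filter ((_≟ q + c) ∘ (q +_) ∘ proj₂) (colouredNeighbours v L))
        ≡⟨ cong (map (recolour q)) (filter-≐ _ ((_≟ c) ∘ proj₂)
             ((λ {x} → ℕₚ.+-cancelˡ-≡ q (proj₂ x) c) , cong (q +_)) (colouredNeighbours v L)) ⟩
      map (recolour q) (clashes v c L) ∎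
      where open ≡-Reasoning

    bad-recolour : ∀ q L → bad (map (recolour q) L) ≡ bad L
    bad-recolour q []            = refl
    bad-recolour q ((v , c) ∷ L) = cong₂ _+_
      (trans (cong length (clashes-recolour q v c L)) (length-map (recolour q) (clashes v c L)))
      (bad-recolour q L)

    bad-++-disjoint : ∀ L M → All (λ (_ , c) → All (λ (_ , d) → d ≢ c) M) L →
                      bad (L ++ M) ≡ bad L + bad M
    bad-++-disjoint []            M []               = refl
    bad-++-disjoint ((v , c) ∷ L) M (c∉M ∷ disjoint) = begin
      length (clashes v c (L ++ M)) + bad (L ++ M)
        ≡⟨ cong₂ _+_ (cong length (trans (clashes-++ v c L M) (cong (clashes v c L ++_) none)))
                     (bad-++-disjoint L M disjoint) ⟩
      length (clashes v c L ++ []) + (bad L + bad M)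
        ≡⟨ cong (_+ (bad L + bad M)) (trans (length-++ (clashes v c L)) (ℕₚ.+-identityʳ _)) ⟩
      length (clashes v c L) + (bad L + bad M)
        ≡⟨ ℕₚ.+-assoc (length (clashes v c L)) (bad L) (bad M) ⟨
      length (clashes v c L) + bad L + bad M ∎
      where
      open ≡-Reasoning
      none : clashes v c M ≡ []
      none = filter-none ((_≟ c) ∘ proj₂) (Allₚ.filter⁺ (adj? G v ∘ proj₁) c∉M)

    -- A colouring is a list of pairs, matched with `W` up to permutation, so that colourings of
    -- disjoint parts can be concatenated in any order.
    record Colour (W : List (Fin n)) (q b : ℕ) : Set where
      constructor colour
      field
        coloured : Coloured
        covers   : map proj₁ coloured ↭ W
        colours< : All ((_< q) ∘ proj₂) coloured
        few-bad  : bad coloured ≤ b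

    colour-resp-↭ : ∀ {W W′} → W ↭ W′ → Colour W q b → Colour W′ q b
    colour-resp-↭ W↭W′ (colour L L↭W L<q bad≤b) = colour L (↭-trans L↭W W↭W′) L<q bad≤b

    colour-mono : ∀ {W} → q ≤ q′ → b ≤ b′ → Colour W q b → Colour W q′ b′
    colour-mono q≤q′ b≤b′ (colour L L↭W L<q bad≤b) =
      colour L L↭W (All.map (λ c<q → ℕₚ.<-≤-trans c<q q≤q′) L<q) (ℕₚ.≤-trans bad≤b b≤b′)

    colour-[] : Colour [] 0 0
    colour-[] = colour [] ↭-refl [] z≤n

    -- The colours of the second part are shifted by `q`, so no edge between the parts is
    -- monochromatic and the costs simply add.
    colour-++ : ∀ {W W′} → Colour W q b → Colour W′ q′ b′ → Colour (W ++ W′) (q + q′) (b + b′)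
    colour-++ {q = q} {b} {q′} {b′} {W} {W′} (colour L L↭W L<q bad≤b) (colour M M↭W′ M<q′ bad≤b′) =
      colour (L ++ M′) covers
        (Allₚ.++⁺ (All.map (λ c<q → ℕₚ.<-≤-trans c<q (ℕₚ.m≤m+n q q′)) L<q)
                  (Allₚ.map⁺ (All.map (ℕₚ.+-monoʳ-< q) M<q′)))
        (begin
          bad (L ++ M′)  ≡⟨ bad-++-disjoint L M′ (All.map (λ {x} → disjoint {x}) L<q) ⟩
          bad L + bad M′ ≡⟨ cong (bad L +_) (bad-recolour q M) ⟩
          bad L + bad M  ≤⟨ ℕₚ.+-mono-≤ bad≤b bad≤b′ ⟩
          b + b′         ∎)
      where
      open ℕₚ.≤-Reasoning
      M′ : Coloured
      M′ = map (recolour q) M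

      disjoint : ∀ {x : Fin n × ℕ} → proj₂ x < q → All (λ (_ , d) → d ≢ proj₂ x) M′
      disjoint c<q = Allₚ.map⁺ (All.universal
        (λ (_ , d) q+d≡c → ℕₚ.<-irrefl refl (ℕₚ.≤-<-trans (ℕₚ.m≤m+n q d) (subst (_< q) (sym q+d≡c) c<q))) M)

      covers : map proj₁ (L ++ M′) ↭ W ++ W′
      covers = ↭-trans (↭-reflexive (trans (map-++ proj₁ L M′) (cong (map proj₁ L ++_) (sym (map-∘ {g = proj₁} M)))))
                       (↭ₚ.++⁺ L↭W M↭W′)

    plain : Fin n → Fin n × ℕ
    plain v = v , 0

    map-proj₁-plain : ∀ W → map proj₁ (map plain W) ≡ W
    map-proj₁-plain W = trans (sym (map-∘ {g = proj₁} W)) (map-id W)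

    -- This crude bound ends the recursion over scales and settles the case of small `k`.
    colour-all : ∀ W → Colour W 1 (length W * length W)
    colour-all W = colour L (↭-reflexive (map-proj₁-plain W)) (Allₚ.map⁺ (All.universal (λ _ → s≤s z≤n) W))
      (subst (λ l → bad L ≤ l * l) (length-map plain W) (bad≤ L))
      where
      L : Coloured
      L = map plain W

    Independent : List (Fin n) → Set
    Independent W = ∀ {x y} → x ∈ W → y ∈ W → ¬ Adj G x y

    colour-independent : ∀ {W} → Independent W → Colour W 1 0
    colour-independent {W} indep = colour (map plain W) (↭-reflexive (map-proj₁-plain W))
      (Allₚ.map⁺ (All.universal (λ _ → s≤s z≤n) W)) (ℕₚ.≤-reflexive (no-bad W indep))
      where
      no-bad : ∀ W → Independent W → bad (map plain W) ≡ 0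
      no-bad []      _     = refl
      no-bad (v ∷ W) indep = cong₂ _+_
        (cong (length ∘ filter ((_≟ 0) ∘ proj₂))
          (filter-none (adj? G v ∘ proj₁)
            (Allₚ.map⁺ (All.tabulate λ y∈W → indep (here refl) (there y∈W)))))
        (no-bad W (λ x∈W y∈W → indep (there x∈W) (there y∈W)))

    degree : Fin n → List (Fin n) → ℕ
    degree v W = length (filter (adj? G v) W)

    -- The new vertex takes the colour that is rarest among its coloured neighbours; `b′` counts the
    -- edges that this makes monochromatic.
    colour-greedily : ∀ {W} v → .{{NonZero q}} → Colour W q b →
                      ∃[ b′ ] q * b′ ≤ degree v W × Colour (v ∷ W) q (b′ + b)
    colour-greedily {q = suc m} {W = W} v (colour L L↭W L<q bad≤b)
      with rare-colour m (map proj₂ (colouredNeighbours v L))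
    ... | c , c≤m , rare =
      length (clashes v c L) ,
      (begin
        suc m * length (clashes v c L)
          ≡⟨ cong (suc m *_) occ ⟨
        suc m * occurrences c (map proj₂ N)
          ≤⟨ rare ⟩
        length (map proj₂ N)
          ≡⟨ trans (length-map proj₂ N) (sym (length-map proj₁ N)) ⟩
        length (map proj₁ N)
          ≡⟨ cong length (filter-map (adj? G v) proj₁ L) ⟨
        degree v (map proj₁ L)
          ≡⟨ ↭-length (filter-↭ (adj? G v) L↭W) ⟩
        degree v W ∎) ,
      colour ((v , c) ∷ L) (prep v L↭W) (s≤s c≤m ∷ L<q) (ℕₚ.+-monoʳ-≤ _ bad≤b)
      where
      open ℕₚ.≤-Reasoning
      N : Coloured
      N = colouredNeighbours v L
      occ : occurrences c (map proj₂ N) ≡ length (clashes v c L)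
      occ = trans (cong length (filter-map (_≟ c) proj₂ N)) (length-map proj₂ (clashes v c L))

    -- From monochromatic edges to deleted edges

    orient : Fin n → Fin n → Fin n × Fin n
    orient x y with x Finₚ.<? y
    ... | yes _ = x , y
    ... | no  _ = y , x

    badEdges : Coloured → List (Fin n × Fin n)
    badEdges []            = []
    badEdges ((v , c) ∷ L) = map (orient v ∘ proj₁) (clashes v c L) ++ badEdges L

    length-badEdges : ∀ L → length (badEdges L) ≡ bad L
    length-badEdges []            = refl
    length-badEdges ((v , c) ∷ L) =
      trans (length-++ (map (orient v ∘ proj₁) (clashes v c L)))
            (cong₂ _+_ (length-map _ (clashes v c L)) (length-badEdges L))

    orient-< : ∀ {x y} → x Fin.< y → orient x y ≡ (x , y)
    orient-< {x} {y} x<y with x Finₚ.<? y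
    ... | yes _   = refl
    ... | no  x≮y = contradiction x<y x≮y

    orient-> : ∀ {x y} → x Fin.< y → orient y x ≡ (x , y)
    orient-> {x} {y} x<y with y Finₚ.<? x
    ... | yes y<x = contradiction x<y (Finₚ.<-asym y<x)
    ... | no  _   = refl

    ∈-clashes : ∀ {x y c L} → Adj G x y → (y , c) ∈ L → (y , c) ∈ clashes x c L
    ∈-clashes {x} {c = c} a y∈L =
      ∈-filter⁺ ((_≟ c) ∘ proj₂) (∈-filter⁺ (adj? G x ∘ proj₁) y∈L a) refl

    ∈-badEdges : ∀ {x y c} L → x Fin.< y → Adj G x y → (x , c) ∈ L → (y , c) ∈ L →
                 (x , y) ∈ badEdges L
    ∈-badEdges (_ ∷ _) x<y _ (here refl) (here refl) = contradiction x<y (Finₚ.<-irrefl refl)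
    ∈-badEdges {x} (_ ∷ L) x<y a (here refl) (there y∈L) = ∈-++⁺ˡ
      (subst (_∈ _) (orient-< x<y) (∈-map⁺ (orient x ∘ proj₁) (∈-clashes a y∈L)))
    ∈-badEdges {y = y} (_ ∷ L) x<y a (there x∈L) (here refl) = ∈-++⁺ˡ
      (subst (_∈ _) (orient-> x<y) (∈-map⁺ (orient y ∘ proj₁) (∈-clashes (adj-sym G a) x∈L)))
    ∈-badEdges ((v , c) ∷ L) x<y a (there x∈L) (there y∈L) =
      ∈-++⁺ʳ (map (orient v ∘ proj₁) (clashes v c L)) (∈-badEdges L x<y a x∈L y∈L)

    -- Deleting the monochromatic edges makes the colouring proper. They are listed without
    -- repetition in `edges D`, and all of them occur in `badEdges L`.
    colour⇒hᴳ≤ : ∀ k → q ≤ k → Colour (allFin n) q b → hᴳ G k ≤ b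
    colour⇒hᴳ≤ {q = q} {b} k q≤k (colour L covers L<q bad≤b) = begin
      hᴳ G k              ≤⟨ hᴳ-minimal G k D (λ _ _ → proj₁) (col , proper) ⟩
      e D                 ≤⟨ unique-⊆⇒length≤ unique edges⊆ ⟩
      length (badEdges L) ≡⟨ length-badEdges L ⟩
      bad L               ≤⟨ bad≤b ⟩
      b                   ∎
      where
      open ℕₚ.≤-Reasoning

      entry : ∀ v → ∃[ c ] (v , c) ∈ L
      entry v with ∈-map⁻ proj₁ (∈-resp-↭ (↭-sym covers) (∈-allFin v))
      ... | (_ , c) , v∈L , refl = c , v∈L

      c<k : ∀ v → proj₁ (entry v) < k
      c<k v = ℕₚ.<-≤-trans (All.lookup L<q (proj₂ (entry v))) q≤k

      col : Fin n → Fin k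
      col v = fromℕ< (c<k v)

      D : Graph n
      D = record
        { Adj        = λ x y → Adj G x y × col x ≡ col y
        ; adj?       = λ x y → adj? G x y ×-dec (col x Finₚ.≟ col y)
        ; adj-sym    = λ (a , eq) → adj-sym G a , sym eq
        ; adj-irrefl = λ x≡y → adj-irrefl G x≡y ∘ proj₁
        }

      proper : Proper (G ─ D) col
      proper x y (a , ¬d) eq = ¬d (a , eq)

      edge? : Decidable (λ ((x , y) : Fin n × Fin n) → x Fin.< y × Adj D x y)
      edge? (x , y) = x Finₚ.<? y ×-dec adj? D x y

      unique : UniqueList (edges D)
      unique = Uniqueₚ.filter⁺ edge?
        (Uniqueₚ.cartesianProduct⁺ (Uniqueₚ.allFin⁺ n) (Uniqueₚ.allFin⁺ n))

      edges⊆ : ∀ {p} → p ∈ edges D → p ∈ badEdges L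
      edges⊆ {x , y} p∈ with ∈-filter⁻ edge? {xs = cartesianProduct (allFin n) (allFin n)} p∈
      ... | _ , x<y , a , eq = ∈-badEdges L x<y a (proj₂ (entry x))
        (subst (λ c → (y , c) ∈ L) (sym (Finₚ.fromℕ<-injective _ _ (c<k x) (c<k y) eq)) (proj₂ (entry y)))

  -- Peeling off spheres

  ^-distribʳ-* : ∀ a b m → (a * b) ^ m ≡ a ^ m * b ^ m
  ^-distribʳ-* a b zero    = refl
  ^-distribʳ-* a b (suc m) =
    trans (cong (a * b *_) (^-distribʳ-* a b m)) (interchange a b (a ^ m) (b ^ m))
    where
    interchange : ∀ a b x y → a * b * (x * y) ≡ a * x * (b * y)
    interchange = solve-∀

  module Peeling {n r : ℕ} (G : Graph n) (noOddWalk : NoOddWalk r G) where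

    open Colouring G

    neighbour? : ∀ S → Decidable (λ x → Any (Adj G x) S)
    neighbour? S x = Any.any? (adj? G x) S

    -- End points of walks of length i whose later vertices lie in W; the walks may backtrack, so
    -- these need not be vertices at distance i.
    sphere : List (Fin n) → Fin n → ℕ → List (Fin n)
    sphere W v zero    = [ v ]
    sphere W v (suc i) = filter (neighbour? (sphere W v i)) W

    sphere-walk : ∀ W v i {x} → x ∈ sphere W v i → Walk G i v x
    sphere-walk W v zero    (here refl) = []
    sphere-walk W v (suc i) x∈
      with _ , nbr ← ∈-filter⁻ (neighbour? (sphere W v i)) {xs = W} x∈
      with y , y∈ , a ← find nbr = walk-∷ʳ (sphere-walk W v i y∈) (adj-sym G a)

    -- An edge inside the sphere would join two walks of length `i` from `v` into a closed walk of
    -- odd length `2 * i + 1`.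
    sphere-independent : ∀ W v {i} → i ≤ r → Independent (sphere W v i)
    sphere-independent W v {i} i≤r x∈ y∈ a =
      noOddWalk i≤r (subst (λ ℓ → Walk G ℓ v v) (odd i)
        (sphere-walk W v i x∈ ⧺ a ∷ reverse (sphere-walk W v i y∈)))
      where
      odd : ∀ i → i + suc i ≡ suc (2 * i)
      odd = solve-∀

    length-sphere-1 : ∀ W v → length (sphere W v 1) ≡ degree v W
    length-sphere-1 W v = cong length (filter-≐ (neighbour? [ v ]) (adj? G v)
      ((λ { (here a) → adj-sym G a }) , λ a → here (adj-sym G a)) W)

    module _ (K : ℕ) .{{_ : NonZero K}} where

      -- If none of the first `j` steps is slow, the size grows `j` times by a factor of at least
      -- `K`, starting from `degree v W`. A slow sphere is nonempty, so that removing it makes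
      -- progress.
      slow-sphere : ∀ W v j → 0 < degree v W →
        (∃[ i ] i < j × length (sphere W v (2 + i)) ≤ K * length (sphere W v (1 + i))
                      × 0 < length (sphere W v (1 + i)))
        ⊎ degree v W * K ^ j ≤ length (sphere W v (1 + j))
      slow-sphere W v zero    _   = inj₂ (ℕₚ.≤-reflexive
        (trans (ℕₚ.*-identityʳ _) (sym (length-sphere-1 W v))))
      slow-sphere W v (suc j) 0<d with slow-sphere W v j 0<d
      ... | inj₁ (i , i<j , slow , 0<) = inj₁ (i , ℕₚ.m<n⇒m<1+n i<j , slow , 0<)
      ... | inj₂ big with length (sphere W v (2 + j)) ≤? K * length (sphere W v (1 + j))
      ...   | yes slow = inj₁ (j , ℕₚ.≤-refl , slow ,
        ℕₚ.<-≤-trans (ℕₚ.*-mono-< 0<d (ℕₚ.m^n>0 K j)) big)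
      ...   | no fast = inj₂ (begin
        degree v W * (K * K ^ j)        ≡⟨ swap-factors (degree v W) K (K ^ j) ⟩
        K * (degree v W * K ^ j)        ≤⟨ ℕₚ.*-monoʳ-≤ K big ⟩
        K * length (sphere W v (1 + j)) ≤⟨ ℕₚ.≰⇒≥ fast ⟩
        length (sphere W v (2 + j))     ∎)
        where
        open ℕₚ.≤-Reasoning
        swap-factors : ∀ a b c → a * (b * c) ≡ b * (a * c)
        swap-factors = solve-∀

      module _ (N : ℕ) where

        -- P collects the postponed neighbourhoods of the spheres that make up I.
        record Peeled (W : List (Fin n)) : Set where
          constructor peeled
          field
            {I A P} : List (Fin n)
            {b}     : ℕ
            split   : W ↭ I ++ A ++ P
            I-indep : Independent I
            A-col   : Colour A K b
            b-small : b * K ^ suc r ≤ length A * N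
            P-small : length P ≤ K * length I

        -- Greedy colouring of `v` costs at most `N / K ^ suc r` edges, which is what one more
        -- vertex in `A` adds to the allowance `b-small`.
        peel-low : ∀ {W W′ v} → W ↭ v ∷ W′ → degree v W * K ^ r ≤ N → Peeled W′ → Peeled W
        peel-low {W} {W′} {v} W↭ low (peeled {I} {A} {P} {b} split I-indep A-col b-small P-small)
          with b′ , Kb′≤ , A-col′ ← colour-greedily v A-col =
          peeled split′ I-indep A-col′ b-small′ P-small
          where
          split′ : W ↭ I ++ (v ∷ A) ++ P
          split′ = ↭-trans W↭ (↭-trans (prep v split) (↭-sym (↭ₚ.shift v I (A ++ P))))

          degree-↭ : ∀ {U U′} → U ↭ U′ → degree v U ≡ degree v U′
          degree-↭ U↭ = ↭-length (filter-↭ (adj? G v) U↭)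

          degree-++ : ∀ U U′ → degree v (U ++ U′) ≡ degree v U + degree v U′
          degree-++ U U′ = trans (cong length (filter-++ (adj? G v) U U′)) (length-++ (filter (adj? G v) U))

          open ℕₚ.≤-Reasoning

          degree≤ : degree v A ≤ degree v W
          degree≤ = begin
            degree v A                                       ≤⟨ ℕₚ.m≤m+n _ _ ⟩
            degree v A + degree v P                          ≡⟨ degree-++ A P ⟨
            degree v (A ++ P)                                ≤⟨ ℕₚ.m≤n+m _ _ ⟩
            degree v (v ∷ I) + degree v (A ++ P)             ≡⟨ degree-++ (v ∷ I) (A ++ P) ⟨
            degree v (v ∷ I ++ A ++ P)                       ≡⟨ degree-↭ (↭-trans W↭ (prep v split)) ⟨
            degree v W                                       ∎

          rearrange : ∀ a k p → a * (k * p) ≡ (k * a) * p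
          rearrange = solve-∀

          b-small′ : (b′ + b) * K ^ suc r ≤ N + length A * N
          b-small′ = begin
            (b′ + b) * K ^ suc r            ≡⟨ ℕₚ.*-distribʳ-+ (K ^ suc r) b′ b ⟩
            b′ * (K * K ^ r) + b * K ^ suc r ≡⟨ cong (_+ b * K ^ suc r) (rearrange b′ K (K ^ r)) ⟩
            (K * b′) * K ^ r + b * K ^ suc r ≤⟨ ℕₚ.+-mono-≤ (ℕₚ.*-monoˡ-≤ (K ^ r) (ℕₚ.≤-trans Kb′≤ degree≤)) b-small ⟩
            degree v W * K ^ r + length A * N ≤⟨ ℕₚ.+-monoˡ-≤ _ low ⟩
            N + length A * N ∎

        module SlowSphere (W : List (Fin n)) (v : Fin n) (i : ℕ) (i<r : i < r)
                          (slow : length (sphere W v (2 + i)) ≤ K * length (sphere W v (1 + i))) where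

          S W₁ T W₂ : List (Fin n)
          S  = sphere W v (1 + i)
          -- `S` unfolds to the filter of `W` by the same predicate, so `W₁` is the complement of
          -- `S` in `W`.
          W₁ = filter (¬? ∘ neighbour? (sphere W v i)) W
          T  = filter (neighbour? S) W₁
          W₂ = filter (¬? ∘ neighbour? S) W₁

          W↭S++W₁ : W ↭ S ++ W₁
          W↭S++W₁ = filter-split (neighbour? (sphere W v i)) W

          W₁↭T++W₂ : W₁ ↭ T ++ W₂
          W₁↭T++W₂ = filter-split (neighbour? S) W₁

          length-S+W₂≤ : length S + length W₂ ≤ length W
          length-S+W₂≤ = begin
            length S + length W₂              ≤⟨ ℕₚ.+-monoʳ-≤ (length S) (ℕₚ.m≤n+m _ (length T)) ⟩
            length S + (length T + length W₂) ≡⟨ cong (length S +_) (length-split T W₁↭T++W₂) ⟨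
            length S + length W₁              ≡⟨ length-split S W↭S++W₁ ⟨
            length W                          ∎
            where open ℕₚ.≤-Reasoning

          -- `T` is the part of the next sphere that lies outside `S`.
          T-small : length T ≤ K * length S
          T-small = begin
            length T                                      ≤⟨ ℕₚ.m≤n+m _ _ ⟩
            length (filter (neighbour? S) S) + length T
              ≡⟨ length-split (filter (neighbour? S) S) (↭-trans (filter-↭ (neighbour? S) W↭S++W₁)
                   (↭-reflexive (filter-++ (neighbour? S) S W₁))) ⟨
            length (sphere W v (2 + i))                   ≤⟨ slow ⟩
            K * length S                                  ∎
            where open ℕₚ.≤-Reasoning

          -- Postponing `T` leaves no neighbour of `S` in `W₂`, so `S` can join the independent set
          -- found there.
          peel-sphere : Peeled W₂ → Peeled W
          peel-sphere (peeled {I} {A} {P} split I-indep A-col b-small P-small) =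
            peeled split′ S++I-indep A-col b-small T++P-small
            where
            split′ : W ↭ (S ++ I) ++ A ++ (T ++ P)
            split′ = begin
              W                           ↭⟨ W↭S++W₁ ⟩
              S ++ W₁                     ↭⟨ ↭ₚ.++⁺ˡ S W₁↭T++W₂ ⟩
              S ++ T ++ W₂                ↭⟨ ↭ₚ.++⁺ˡ S (↭ₚ.++⁺ˡ T split) ⟩
              S ++ T ++ I ++ A ++ P       ↭⟨ ↭ₚ.++⁺ˡ S (↭ₚ.shifts T I) ⟩
              S ++ I ++ T ++ A ++ P       ↭⟨ ↭ₚ.++⁺ˡ S (↭ₚ.++⁺ˡ I (↭ₚ.shifts T A)) ⟩
              S ++ I ++ A ++ T ++ P       ↭⟨ ↭ₚ.++-assoc S I (A ++ T ++ P) ⟨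
              (S ++ I) ++ A ++ T ++ P     ∎
              where open PermutationReasoning

            far : ∀ {x y} → x ∈ S → y ∈ I → ¬ Adj G y x
            far x∈S y∈I a = proj₂ (∈-filter⁻ (¬? ∘ neighbour? S) {xs = W₁}
              (∈-resp-↭ (↭-sym split) (∈-++⁺ˡ y∈I))) (lose x∈S a)

            S++I-indep : Independent (S ++ I)
            S++I-indep x∈ y∈ a with ∈-++⁻ S x∈ | ∈-++⁻ S y∈
            -- `S` is the sphere of index `1 + i`, and `i < r` is the bound `1 + i ≤ r` that
            -- independence asks for.
            ... | inj₁ x∈S | inj₁ y∈S = sphere-independent W v i<r x∈S y∈S a
            ... | inj₁ x∈S | inj₂ y∈I = far x∈S y∈I (adj-sym G a)
            ... | inj₂ x∈I | inj₁ y∈S = far y∈S x∈I a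
            ... | inj₂ x∈I | inj₂ y∈I = I-indep x∈I y∈I a

            T++P-small : length (T ++ P) ≤ K * length (S ++ I)
            T++P-small = begin
              length (T ++ P)             ≡⟨ length-++ T ⟩
              length T + length P         ≤⟨ ℕₚ.+-mono-≤ T-small P-small ⟩
              K * length S + K * length I ≡⟨ ℕₚ.*-distribˡ-+ K (length S) (length I) ⟨
              K * (length S + length I)   ≡⟨ cong (K *_) (length-++ S) ⟨
              K * length (S ++ I)         ∎
              where open ℕₚ.≤-Reasoning

        -- Low vertices are removed as long as there are any; otherwise a slow sphere around the
        -- first vertex is removed.
        peel : ∀ W → Acc _<_ (length W) → length W ≤ N → Peeled W
        peel W (acc rec) W≤N with Any.any? (λ v → degree v W * K ^ r ≤? N) W
        ... | yes low
          with v , v∈W , low-v ← find low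
          with as , bs , W≡ ← ∈-∃++ v∈W =
          peel-low W↭ low-v (peel (as ++ bs) (rec W′<W) (ℕₚ.≤-trans (ℕₚ.<⇒≤ W′<W) W≤N))
          where
          W↭ : W ↭ v ∷ as ++ bs
          W↭ = ↭-trans (↭-reflexive W≡) (↭ₚ.shift v as bs)
          W′<W : length (as ++ bs) < length W
          W′<W = ℕₚ.≤-reflexive (sym (↭-length W↭))
        peel []        _         _   | no _ =
          peeled {I = []} {A = []} {P = []} {b = 0} ↭-refl (λ ()) (colour-mono z≤n z≤n colour-[]) z≤n z≤n
        peel W@(v ∷ _) (acc rec) W≤N | no none
          with slow-sphere W v r (ℕₚ.n≢0⇒n>0 d≢0)
          where
          high : N < degree v W * K ^ r
          high = ℕₚ.≰⇒> (none ∘ here)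
          d≢0 : degree v W ≢ 0
          d≢0 d≡0 = ℕₚ.n≮0 (subst (λ d → N < d * K ^ r) d≡0 high)
        ... | inj₁ (i , i<r , slow , 0<S) =
          peel-sphere (peel W₂ (rec W₂<W) (ℕₚ.≤-trans (ℕₚ.<⇒≤ W₂<W) W≤N))
          where
          open SlowSphere W v i i<r slow
          W₂<W : length W₂ < length W
          W₂<W = ℕₚ.≤-trans (ℕₚ.+-monoˡ-≤ (length W₂) 0<S) length-S+W₂≤
        -- Without a slow sphere, `degree v W * K ^ r` is at most the size of a sphere inside `W`,
        -- hence at most `N`, and `v` would be low.
        ... | inj₂ big = contradiction (here (ℕₚ.≤-trans big
          (ℕₚ.≤-trans (length-filter (neighbour? (sphere W v r)) W) W≤N))) none

      -- Colouring in levels of decreasing scale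

      module Levels (M N : ℕ) where

        -- Amortised accounting: each vertex of `S` pays for `4 * M * K / N` colours and
        -- `N / K ^ suc r` monochromatic edges. Such bounds add up over stages.
        record Partial (W : List (Fin n)) : Set where
          constructor partial
          field
            {S rest} : List (Fin n)
            {q b}    : ℕ
            split    : W ↭ S ++ rest
            S-col    : Colour S q b
            q-small  : q * N ≤ 4 * M * K * length S
            b-small  : b * K ^ suc r ≤ length S * N

        open Partial using (rest)

        -- If `A` takes less than half of `W`, then `I` and `P` take more than half, and together
        -- they have at most `2 * K * i` vertices.
        larger-part : ∀ {a w i p} → w ≡ i + (a + p) → 2 * a < w → p ≤ K * i → w ≤ 4 * (K * i)
        larger-part {a} {w} {i} {p} w≡ 2a<w p≤Ki = ℕₚ.+-cancelʳ-≤ w _ _ (begin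
          w + w                       ≡⟨ cong₂ _+_ w≡ w≡ ⟩
          i + (a + p) + (i + (a + p)) ≡⟨ double i a p ⟩
          2 * (i + p) + 2 * a         ≤⟨ ℕₚ.+-mono-≤ (ℕₚ.*-monoʳ-≤ 2 (ℕₚ.+-mono-≤ (ℕₚ.m≤n*m i K) p≤Ki)) (ℕₚ.<⇒≤ 2a<w) ⟩
          2 * (K * i + K * i) + w     ≡⟨ cong (_+ w) (fourfold (K * i)) ⟩
          4 * (K * i) + w             ∎)
          where
          open ℕₚ.≤-Reasoning
          double : ∀ i a p → i + (a + p) + (i + (a + p)) ≡ 2 * (i + p) + 2 * a
          double = solve-∀
          fourfold : ∀ x → 2 * (x + x) ≡ 4 * x
          fourfold = solve-∀

        -- Either `A` has at least half of the more than `N / M` vertices and takes `K` colours, or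
        -- `I` has at least a fraction `1 / (4 * K)` of them and takes one colour. Both fit the rate
        -- of `Partial`.
        stage : ∀ W → length W ≤ N → N < M * length W →
                ∃[ p ] length (rest {W} p) < length W
        stage W W≤N N<MW with peel N W (<-wellFounded _) W≤N
        ... | peeled {I} {A} {P} {b} split I-indep A-col b-small P-small
          with length W ≤? 2 * length A
        ...   | yes W≤2A = partial (↭-trans split (↭ₚ.shifts I A)) A-col q-small b-small , rest<W
          where
          open ℕₚ.≤-Reasoning
          rearrange : ∀ k m a → k * (m * (2 * a)) + 2 * m * k * a ≡ 4 * m * k * a
          rearrange = solve-∀
          q-small : K * N ≤ 4 * M * K * length A
          q-small = begin
            K * N                      ≤⟨ ℕₚ.*-monoʳ-≤ K (ℕₚ.<⇒≤ N<MW) ⟩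
            K * (M * length W)         ≤⟨ ℕₚ.*-monoʳ-≤ K (ℕₚ.*-monoʳ-≤ M W≤2A) ⟩
            -- The left side is only `2 * M * K * length A`; it is doubled to match the rate that
            -- `I` requires.
            K * (M * (2 * length A))   ≤⟨ ℕₚ.m≤m+n _ (2 * M * K * length A) ⟩
            K * (M * (2 * length A)) + 2 * M * K * length A ≡⟨ rearrange K M (length A) ⟩
            4 * M * K * length A       ∎
          0<A : 0 < length A
          0<A = ℕₚ.n≢0⇒n>0 λ A≡0 → ℕₚ.n≮0 (ℕₚ.<-≤-trans N<MW (ℕₚ.≤-reflexive
            (trans (cong (M *_) (ℕₚ.n≤0⇒n≡0 (subst (λ a → length W ≤ 2 * a) A≡0 W≤2A))) (ℕₚ.*-zeroʳ M))))
          rest<W : length (I ++ P) < length W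
          rest<W = ℕₚ.≤-trans (ℕₚ.+-monoˡ-≤ _ 0<A)
            (ℕₚ.≤-reflexive (sym (length-split A (↭-trans split (↭ₚ.shifts I A)))))
        ...   | no W≰2A =
          partial split (colour-independent I-indep) q-small z≤n , rest<W
          where
          open ℕₚ.≤-Reasoning
          rearrange : ∀ m k i → m * (4 * (k * i)) ≡ 4 * m * k * i
          rearrange = solve-∀
          W≤ : length W ≤ 4 * (K * length I)
          W≤ = larger-part (trans (length-split I split) (cong (length I +_) (length-++ A)))
                           (ℕₚ.≰⇒> W≰2A) P-small
          q-small : 1 * N ≤ 4 * M * K * length I
          q-small = begin
            1 * N                       ≡⟨ ℕₚ.*-identityˡ N ⟩
            N                           ≤⟨ ℕₚ.<⇒≤ N<MW ⟩
            M * length W                ≤⟨ ℕₚ.*-monoʳ-≤ M W≤ ⟩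
            M * (4 * (K * length I))    ≡⟨ rearrange M K (length I) ⟩
            4 * M * K * length I        ∎
          0<I : 0 < length I
          0<I = ℕₚ.n≢0⇒n>0 λ I≡0 → ℕₚ.n≮0 (ℕₚ.<-≤-trans (ℕₚ.≰⇒> W≰2A) (ℕₚ.≤-trans W≤
            (ℕₚ.≤-reflexive (cong (4 *_) (trans (cong (K *_) I≡0) (ℕₚ.*-zeroʳ K))))))
          rest<W : length (A ++ P) < length W
          rest<W = ℕₚ.≤-trans (ℕₚ.+-monoˡ-≤ _ 0<I) (ℕₚ.≤-reflexive (sym (length-split I split)))

        -- Stages are repeated with `N` held fixed while `W` shrinks, so all of them charge at the
        -- same rate.
        level : ∀ W → Acc _<_ (length W) → length W ≤ N → ∃[ p ] M * length (rest {W} p) ≤ N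
        level W (acc rec) W≤N with M * length W ≤? N
        ... | yes MW≤N = partial ↭-refl colour-[] z≤n z≤n , MW≤N
        ... | no  MW≰N
          with partial {S} {R} {q} {b} split S-col q-small b-small , R<W ← stage W W≤N (ℕₚ.≰⇒> MW≰N)
          with partial {S′} {R′} {q′} {b′} split′ S′-col q′-small b′-small , R′-small
                 ← level R (rec R<W) (ℕₚ.≤-trans (ℕₚ.<⇒≤ R<W) W≤N) =
          partial {rest = R′}
            (↭-trans split (↭-trans (↭ₚ.++⁺ˡ S split′) (↭-sym (↭ₚ.++-assoc S S′ R′))))
            (colour-++ S-col S′-col) q-small″ b-small″ , R′-small
          where
          open ℕₚ.≤-Reasoning
          q-small″ : (q + q′) * N ≤ 4 * M * K * length (S ++ S′)
          q-small″ = begin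
            (q + q′) * N                                          ≡⟨ ℕₚ.*-distribʳ-+ N q q′ ⟩
            q * N + q′ * N                                        ≤⟨ ℕₚ.+-mono-≤ q-small q′-small ⟩
            4 * M * K * length S + 4 * M * K * length S′          ≡⟨ ℕₚ.*-distribˡ-+ (4 * M * K) (length S) _ ⟨
            4 * M * K * (length S + length S′)                    ≡⟨ cong (4 * M * K *_) (length-++ S) ⟨
            4 * M * K * length (S ++ S′)                          ∎
          b-small″ : (b + b′) * K ^ suc r ≤ length (S ++ S′) * N
          b-small″ = begin
            (b + b′) * K ^ suc r              ≡⟨ ℕₚ.*-distribʳ-+ (K ^ suc r) b b′ ⟩
            b * K ^ suc r + b′ * K ^ suc r    ≤⟨ ℕₚ.+-mono-≤ b-small b′-small ⟩
            length S * N + length S′ * N      ≡⟨ ℕₚ.*-distribʳ-+ N (length S) _ ⟨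
            (length S + length S′) * N        ≡⟨ cong (_* N) (length-++ S) ⟨
            length (S ++ S′) * N              ∎

    -- Both constants reproduce themselves: for `K = 2 ^ suc p`, the level takes `4 * M * K` colours
    -- and the next scale `8 * M * (K / 2)`, in total `8 * M * K`; each of the two contributes at
    -- most `N * N` to the bound on the cost.
    multilevel : ∀ p W → ∃[ q ] ∃[ b ] Colour W q b × q ≤ 8 * 2 ^ suc r * 2 ^ p
                                     × b * (2 ^ p) ^ suc r ≤ 2 * (length W * length W)
    multilevel zero W = 1 , length W * length W , colour-all W , q-small , b-small
      where
      open ℕₚ.≤-Reasoning
      q-small : 1 ≤ 8 * 2 ^ suc r * 1
      q-small = ℕₚ.*-mono-< {0} {8 * 2 ^ suc r} {0} (ℕₚ.*-mono-< {0} {8} {0} (s≤s z≤n) (ℕₚ.m^n>0 2 (suc r))) (s≤s z≤n)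
      b-small : length W * length W * 1 ^ suc r ≤ 2 * (length W * length W)
      b-small = begin
        length W * length W * 1 ^ suc r ≡⟨ cong (length W * length W *_) (ℕₚ.^-zeroˡ (suc r)) ⟩
        length W * length W * 1         ≡⟨ ℕₚ.*-identityʳ _ ⟩
        length W * length W             ≤⟨ ℕₚ.m≤n*m _ 2 ⟩
        2 * (length W * length W)       ∎
    -- The empty list is split off because `q≤` cancels the factor `N = length W`.
    multilevel (suc p) []        = 0 , 0 , colour-[] , z≤n , z≤n
    multilevel (suc p) W@(_ ∷ _)
      with Levels.level (2 ^ suc p) {{ℕₚ.m^n≢0 2 (suc p)}} (2 ^ suc r) (length W) W (<-wellFounded _) ℕₚ.≤-refl
    ... | Levels.partial {S} {R} {q} {b} split S-col q-small b-small , R-small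
      with multilevel p R
    ... | q′ , b′ , R-col , q′-small , b′-small =
      q + q′ , b + b′ , colour-resp-↭ (↭-sym split) (colour-++ S-col R-col) , q-small″ , b-small″
      where
      open ℕₚ.≤-Reasoning
      K M N : ℕ
      K = 2 ^ suc p
      M = 2 ^ suc r
      N = length W

      S≤N : length S ≤ N
      S≤N = subst (length S ≤_) (sym (length-split S split)) (ℕₚ.m≤m+n _ _)

      q≤ : q ≤ 4 * M * K
      q≤ = ℕₚ.*-cancelʳ-≤ q _ N (ℕₚ.≤-trans q-small (ℕₚ.*-monoʳ-≤ (4 * M * K) S≤N))

      q-small″ : q + q′ ≤ 8 * M * K
      q-small″ = begin
        q + q′                              ≤⟨ ℕₚ.+-mono-≤ q≤ q′-small ⟩
        4 * M * (2 * 2 ^ p) + 8 * M * 2 ^ p ≡⟨ rearrange M (2 ^ p) ⟩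
        8 * M * (2 * 2 ^ p)                 ∎
        where
        rearrange : ∀ m k → 4 * m * (2 * k) + 8 * m * k ≡ 8 * m * (2 * k)
        rearrange = solve-∀

      -- One factor `M` comes from doubling the scale, the other from `2 ≤ M`; together they turn
      -- each `length R` into `M * length R ≤ N`.
      b′≤ : b′ * K ^ suc r ≤ N * N
      b′≤ = begin
        b′ * (2 * 2 ^ p) ^ suc r             ≡⟨ cong (b′ *_) (^-distribʳ-* 2 (2 ^ p) (suc r)) ⟩
        b′ * (M * (2 ^ p) ^ suc r)           ≡⟨ rearrange b′ M _ ⟩
        M * (b′ * (2 ^ p) ^ suc r)           ≤⟨ ℕₚ.*-monoʳ-≤ M b′-small ⟩
        M * (2 * (length R * length R))      ≤⟨ ℕₚ.*-monoʳ-≤ M (ℕₚ.*-monoˡ-≤ _ (ℕₚ.m≤m*n 2 (2 ^ r) {{ℕₚ.m^n≢0 2 r}})) ⟩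
        M * (M * (length R * length R))      ≡⟨ square M (length R) ⟩
        (M * length R) * (M * length R)      ≤⟨ ℕₚ.*-mono-≤ R-small R-small ⟩
        N * N                                ∎
        where
        rearrange : ∀ b m k → b * (m * k) ≡ m * (b * k)
        rearrange = solve-∀
        square : ∀ m l → m * (m * (l * l)) ≡ (m * l) * (m * l)
        square = solve-∀

      b-small″ : (b + b′) * K ^ suc r ≤ 2 * (N * N)
      b-small″ = begin
        (b + b′) * K ^ suc r           ≡⟨ ℕₚ.*-distribʳ-+ (K ^ suc r) b b′ ⟩
        b * K ^ suc r + b′ * K ^ suc r ≤⟨ ℕₚ.+-mono-≤ (ℕₚ.≤-trans b-small (ℕₚ.*-monoˡ-≤ N S≤N)) b′≤ ⟩
        N * N + N * N                  ≡⟨ cong (N * N +_) (ℕₚ.+-identityʳ _) ⟨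
        2 * (N * N)                    ∎

  -- Choosing the scale for a given number of colours

  n<2^n : ∀ n → n < 2 ^ n
  n<2^n zero    = s≤s z≤n
  n<2^n (suc n) = begin-strict
    1 + n           <⟨ ℕₚ.+-monoʳ-< 1 (n<2^n n) ⟩
    1 + 2 ^ n       ≤⟨ ℕₚ.+-mono-≤ (ℕₚ.m^n>0 2 n) (ℕₚ.m≤m+n (2 ^ n) 0) ⟩
    2 ^ suc n       ∎
    where open ℕₚ.≤-Reasoning

  dyadic-bracket : ∀ c k m → k < c * 2 ^ m →
                   k < c ⊎ ∃[ p ] c * 2 ^ p ≤ k × k < c * 2 ^ suc p
  dyadic-bracket c k zero    k<    = inj₁ (subst (k <_) (ℕₚ.*-identityʳ c) k<)
  dyadic-bracket c k (suc m) k< with c * 2 ^ m ≤? k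
  ... | yes ≤k = inj₂ (m , ≤k , k<)
  ... | no  ≰k = dyadic-bracket c k m (ℕₚ.≰⇒> ≰k)

  colours-at-scale : ℕ → ℕ
  colours-at-scale r = 8 * 2 ^ suc r

  -- The leading 2 is the factor in the cost of `multilevel`; the inner 2 allows for `k` lying up to
  -- a factor of 2 above the colours used.
  bound : ℕ → ℕ
  bound r = 2 * (colours-at-scale r * 2) ^ suc r

  hᴳ-bound : (G : Graph n) → Free (oddCycles r) G → (k : ℕ) .{{_ : NonZero k}} →
             hᴳ G k * k ^ suc r ≤ bound r * (n * n)
  hᴳ-bound {n} {r} G free k
    with dyadic-bracket (colours-at-scale r) k k
           (ℕₚ.<-≤-trans (n<2^n k) (ℕₚ.m≤n*m (2 ^ k) _ {{ℕₚ.m*n≢0 8 (2 ^ suc r) {{_}} {{m^n≢0 2 (suc r)}}}}))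
  -- Here `k` is bounded in terms of `r`, so one colour and the trivial cost `n * n` are enough.
  ... | inj₁ k<C = begin
    hᴳ G k * k ^ suc r
      ≤⟨ ℕₚ.*-mono-≤ (colour⇒hᴳ≤ k (>-nonZero⁻¹ k) (colour-all (allFin n)))
                     (ℕₚ.^-monoˡ-≤ (suc r) (ℕₚ.≤-trans (ℕₚ.<⇒≤ k<C) (ℕₚ.m≤m*n C 2))) ⟩
    (length (allFin n) * length (allFin n)) * (C * 2) ^ suc r
      ≡⟨ cong (λ l → l * l * (C * 2) ^ suc r) (length-tabulate {n = n} id) ⟩
    (n * n) * (C * 2) ^ suc r
      ≡⟨ ℕₚ.*-comm (n * n) _ ⟩
    (C * 2) ^ suc r * (n * n)
      ≤⟨ ℕₚ.*-monoˡ-≤ (n * n) (ℕₚ.m≤n*m ((C * 2) ^ suc r) 2) ⟩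
    bound r * (n * n) ∎
    where
    open ℕₚ.≤-Reasoning
    open Colouring G
    C : ℕ
    C = colours-at-scale r
  ... | inj₂ (p , ≤k , k<)
    with q , b , col , q≤ , b≤ ← Peeling.multilevel {r = r} G (free⇒noOddWalk free) p (allFin n) = begin
    hᴳ G k * k ^ suc r
      ≤⟨ ℕₚ.*-mono-≤ (colour⇒hᴳ≤ k (ℕₚ.≤-trans q≤ ≤k) col) (ℕₚ.^-monoˡ-≤ (suc r) (ℕₚ.<⇒≤ k<)) ⟩
    b * (C * (2 * 2 ^ p)) ^ suc r
      ≡⟨ cong (λ x → b * x ^ suc r) (ℕₚ.*-assoc C 2 (2 ^ p)) ⟨
    b * (C * 2 * 2 ^ p) ^ suc r
      ≡⟨ cong (b *_) (^-distribʳ-* (C * 2) (2 ^ p) (suc r)) ⟩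
    b * ((C * 2) ^ suc r * (2 ^ p) ^ suc r)
      ≡⟨ pull b ((C * 2) ^ suc r) ((2 ^ p) ^ suc r) ⟩
    (C * 2) ^ suc r * (b * (2 ^ p) ^ suc r)
      ≤⟨ ℕₚ.*-monoʳ-≤ ((C * 2) ^ suc r) b≤ ⟩
    (C * 2) ^ suc r * (2 * (length (allFin n) * length (allFin n)))
      ≡⟨ cong (λ l → (C * 2) ^ suc r * (2 * (l * l))) (length-tabulate {n = n} id) ⟩
    (C * 2) ^ suc r * (2 * (n * n))
      ≡⟨ regroup ((C * 2) ^ suc r) (n * n) ⟩
    bound r * (n * n) ∎
    where
    open ℕₚ.≤-Reasoning
    open Colouring G
    C : ℕ
    C = colours-at-scale r
    pull : ∀ b x y → b * (x * y) ≡ x * (b * y)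
    pull = solve-∀
    regroup : ∀ x m → x * (2 * m) ≡ 2 * x * m
    regroup = solve-∀

  h-bound : ∀ r n k .{{_ : NonZero k}} →
            h n k (oddCycles r) * k ^ suc r ≤ bound r * (n * n)
  h-bound r n k with h-attained k (oddCycles r) (edgeless n) (edgeless-free n r)
  ... | G , free , hᴳ≡h = subst (λ m → m * k ^ suc r ≤ bound r * (n * n)) hᴳ≡h
                                (hᴳ-bound {r = r} G free k)

-- Passage to rational numbers

open import Data.Integer using (+_)
open import Data.Rational using (ℚ; _/_; _*_; _<_)

-- Cross-multiplication. The comparison is made among unnormalised rationals, since `_/_` reduces
-- fractions to lowest terms.
fraction-< : ∀ a b c d .{{_ : NonZero d}} → a ℕ.* d ℕ.< c ℕ.* b →
             (+ a) / 1 < ((+ c) / 1) * ((+ b) / d)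
fraction-< a b c d@(suc d-1) ad<cb = ℚₚ.toℚᵘ-cancel-<
  (ℚᵘₚ.<-respˡ-≃ (ℚᵘₚ.≃-sym (ℚₚ.toℚᵘ-fromℚᵘ (mkℚᵘ (+ a) 0)))
    (ℚᵘₚ.<-respʳ-≃ (ℚᵘₚ.≃-sym (ℚᵘₚ.≃-trans (ℚₚ.toℚᵘ-homo-* ((+ c) / 1) ((+ b) / d))
        (ℚᵘₚ.*-cong (ℚₚ.toℚᵘ-fromℚᵘ (mkℚᵘ (+ c) 0)) (ℚₚ.toℚᵘ-fromℚᵘ (mkℚᵘ (+ b) d-1)))))
      (*<* (subst₂ ℤ._<_ lhs rhs (ℤ.+<+ ad<cb)))))
  where
  lhs : + (a ℕ.* d) ≡ (+ a) ℤ.* (+ (1 ℕ.* d))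
  lhs = trans (cong (λ m → + (a ℕ.* m)) (sym (ℕₚ.*-identityˡ d))) (ℤₚ.pos-* a (1 ℕ.* d))
  rhs : + (c ℕ.* b) ≡ (+ c) ℤ.* (+ b) ℤ.* (+ 1)
  rhs = trans (ℤₚ.pos-* c b) (sym (ℤₚ.*-identityʳ _))

theorem1p2 : (r : ℕ) .{{_ : NonZero r}} →
    Σ ℚ λ c → (n k : ℕ) .{{_ : NonZero n}} .{{_ : NonZero k}} →
    (+ h n k (oddCycles r)) / 1
    < c * (_/_ (+ (n ^ 2)) (k ^ (r + 1)) {{m^n≢0 k (r + 1)}})
theorem1p2 r = (+ suc (bound r)) / 1 , λ n k →
  fraction-< (h n k (oddCycles r)) (n ^ 2) (suc (bound r)) (k ^ (r + 1)) {{m^n≢0 k (r + 1)}} (begin-strict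
    h n k (oddCycles r) ℕ.* k ^ (r + 1) ≡⟨ cong (λ m → h n k (oddCycles r) ℕ.* k ^ m) (ℕₚ.+-comm r 1) ⟩
    h n k (oddCycles r) ℕ.* k ^ suc r   ≤⟨ h-bound r n k ⟩
    bound r ℕ.* (n ℕ.* n)               ≡⟨ cong (λ m → bound r ℕ.* (n ℕ.* m)) (ℕₚ.*-identityʳ n) ⟨
    -- Strictness comes from the 1 added to `bound r`, because `n ^ 2` is positive.
    bound r ℕ.* n ^ 2                   <⟨ ℕₚ.m<n+m (bound r ℕ.* n ^ 2) (ℕₚ.m^n>0 n 2) ⟩
    suc (bound r) ℕ.* n ^ 2             ∎)
  where open ℕₚ.≤-Reasoning
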